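{- Let $n>2$, $\mathbf{A}=\{a_1,\dots,a_n\}$, and let $\mathbf{S}_2^n=\{XY : X,Y\in\mathbf{A}^*\setminus\{\emptyset\},\ \overline{\nu}(X)=\overline{\nu}(Y)\}$. Then $$L_{min}(\mathbf{S}_2^n)=4n-7.$$
   Context: A word over $\mathbf{A}$ is a finite sequence of letters; $\mathbf{A}^*$ is the set of all words. A subword is a block of consecutive letters. For a word $X$, the content vector is $\overline{\nu}(X)=(\nu_1(X),\dots,\nu_n(X))$, where $\nu_i(X)$ is the number of occurrences of $a_i$ in $X$. For $\mathbf{S}\subseteq\mathbf{A}^*$, a word is free from $\mathbf{S}$ if none of its subwords belongs to $\mathbf{S}$. A word $X$ free from $\mathbf{S}$ is crucial with respect to $\mathbf{S}$ if for every letter $a\in\mathbf{A}$ the word $Xa$ contains a subword belonging to $\mathbf{S}$. $L_{min}(\mathbf{S})$ is the smallest length of a crucial word with respect to $\mathbf{S}$. -}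

module Defs where

open import Data.Fin.Base using (Fin)
open import Data.Fin.Properties using (_≟_)
open import Data.List.Base using (List; []; _++_; _∷ʳ_; length; filter)
open import Data.List.Relation.Binary.Infix.Heterogeneous using (Infix)
open import Data.Nat.Base using (ℕ; _≤_)
open import Data.Product.Base using (_×_; ∃; ∃₂)
open import Data.Vec.Base using (Vec; tabulate)
open import Level using (Level; 0ℓ; _⊔_)
open import Relation.Binary.PropositionalEquality.Core using (_≡_; _≢_)
open import Relation.Nullary.Negation.Core using (¬_)
open import Relation.Unary using (Pred)

module _ {a ℓ : Level} {A : Set a} where

  Contains : Pred (List A) ℓ → Pred (List A) (a ⊔ ℓ)
  Contains S X = ∃ λ U → Infix _≡_ U X × S U

  FreeFrom : Pred (List A) ℓ → Pred (List A) (a ⊔ ℓ)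
  FreeFrom S X = ¬ Contains S X

  Crucial : Pred (List A) ℓ → Pred (List A) (a ⊔ ℓ)
  Crucial S X = FreeFrom S X × (∀ x → Contains S (X ∷ʳ x))

  -- The minimum need not exist for arbitrary S, so it is a relation:
  -- IsLmin S m says that the minimum exists and equals m.
  IsLmin : Pred (List A) ℓ → Pred ℕ (a ⊔ ℓ)
  IsLmin S m = (∃ λ X → Crucial S X × length X ≡ m)
             × (∀ X → Crucial S X → m ≤ length X)

Word : ℕ → Set
Word n = List (Fin n)

ν : ∀ {n} → Fin n → Word n → ℕ
ν i X = length (filter (i ≟_) X)

content : ∀ {n} → Word n → Vec ℕ n
content X = tabulate λ i → ν i X

AbelianSquare : ∀ n → Pred (Word n) 0ℓ
AbelianSquare n W =
  ∃₂ λ X Y → X ≢ [] × Y ≢ [] × content X ≡ content Y × W ≡ X ++ Y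

{-# OPTIONS --safe #-}

-- Upper bound. Name the letters t, z, x₁, …, x_m with m = n − 2. The word
--   x₁ t (x₂ x₁)(x₃ x₂) … (x_m x_{m−1}) z (x₁ x₂ … x_m … x₂ x₁) z
-- has the required length. In every nonempty factor some letter occurs an odd
-- number of times, so no factor is an abelian square. The abelian square
-- completed by x_i consists of the last m − i pairs and everything after them,
-- with its left half ending at the ascending occurrence of x_i.
--
-- Lower bound. If W is crucial, then for each letter a it has a suffix
-- Ω a = X Y with ν(X) = ν(a Y); a has odd and every other letter even
-- multiplicity in Ω a. Let Ω c = X Y be the longest of these suffixes. Every
-- letter occurs in X. Call it light if it occurs there only once. For light
-- letters i ≠ j other than c with |Ω i| ≤ |Ω j|:
-- Ω j contains i twice but Y only once, so Ω j is longer than Y; and Ω c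
-- contains j twice, so Ω j contains j once and Ω i not at all, while Y contains
-- j, so Ω i is shorter than Y. Hence there are at most three light letters,
-- c included, and |X| = |Y| + 1 ≥ 2n − 3.

module Submission where

open import Defs
open import Data.Fin.Base as Fin using (Fin; zero; suc)
open import Data.Fin.Properties using (_≟_; pigeonhole)
open import Data.List.Base
  using (List; []; _∷_; [_]; _++_; _∷ʳ_; _ʳ++_; length; filter; reverse; map; lookup; allFin; tabulate; initLast; _∷ʳ′_)
open import Data.List.Extrema.Nat using (argmax; f[xs]≤f[argmax])
open import Data.List.Membership.Propositional using (_∈_)
open import Data.List.Membership.Propositional.Properties using (∈-allFin; ∈-lookup; ∈-filter⁻)
open import Data.List.Properties
open import Data.List.Relation.Binary.Infix.Heterogeneous as Infix using (Infix; here; there; MkView)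
open import Data.List.Relation.Binary.Permutation.Propositional
  using (_↭_; ↭-refl; ↭-sym; ↭-trans; prep; ↭⇒↭ₛ; module PermutationReasoning)
open import Data.List.Relation.Binary.Permutation.Propositional.Properties
  using (filter-↭; ↭-length; ↭-reverse; shift; All-resp-↭; ++-comm; ++⁺ˡ; ++⁺ʳ)
import Data.List.Relation.Binary.Permutation.Setoid.Properties as Permutationₛ
open import Data.List.Relation.Binary.Pointwise using (Pointwise-≡⇒≡; ≡⇒Pointwise-≡)
open import Data.List.Relation.Binary.Prefix.Heterogeneous as Prefix using ()
open import Data.List.Relation.Unary.All as All using (All; []; _∷_)
open import Data.List.Relation.Unary.All.Properties using (++⁻ˡ) renaming (++⁺ to All-++⁺)
open import Data.List.Relation.Unary.AllPairs using (AllPairs; []; _∷_)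
open import Data.List.Relation.Unary.Any using (here; there)
open import Data.List.Relation.Unary.Unique.Propositional using (Unique)
import Data.List.Relation.Unary.Unique.Propositional.Properties as Unique
open import Data.Nat.Base using (ℕ; zero; suc; _+_; _>_; _*_; _∸_; _≤_; _<_; z≤n; s≤s)
open import Data.Nat.ListAction using (sum)
open import Data.Nat.Properties hiding (_≟_)
open import Data.Nat.Tactic.RingSolver using (solve-∀)
open import Data.Product.Base using (_×_; _,_; proj₁; proj₂; ∃; ∃₂)
open import Data.Sum.Base using (_⊎_; inj₁; inj₂)
open import Data.Vec.Properties using (lookup∘tabulate) renaming (tabulate-cong to Vec-tabulate-cong)
import Data.Vec.Base as Vec
open import Function.Base using (_∘_; case_of_)
import Level
open import Relation.Binary.PropositionalEquality hiding ([_])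
open import Relation.Nullary using (¬_; Dec; yes; no; ¬?; contradiction)
open import Relation.Unary using (Pred; Decidable)

-- Factorizations and permutations of lists

-- Levi's lemma for the free monoid; the overlap in the second case is nonempty, which makes the
-- cases exclusive.
++-split : ∀ {A : Set} (as : List A) {bs} cs {ds} → as ++ bs ≡ cs ++ ds →
           (∃ λ es → cs ≡ as ++ es × bs ≡ es ++ ds)
         ⊎ (∃₂ λ e es → as ≡ cs ++ e ∷ es × ds ≡ e ∷ es ++ bs)
++-split []       cs       eq = inj₁ (cs , refl , eq)
++-split (a ∷ as) []       eq = inj₂ (a , as , refl , sym eq)
++-split (a ∷ as) (c ∷ cs) eq with ∷-injective eq
... | refl , eq′ with ++-split as cs eq′
... | inj₁ (es , p , q)     = inj₁ (es , cong (a ∷_) p , q)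
... | inj₂ (e , es , p , q) = inj₂ (e , es , cong (a ∷_) p , q)

Unique-resp-↭ : ∀ {A : Set} {xs ys : List A} → xs ↭ ys → Unique xs → Unique ys
Unique-resp-↭ {A} p = Permutationₛ.Unique-resp-↭ (setoid A) (↭⇒↭ₛ p)

All-ʳ++ : ∀ {A : Set} {P : Pred A Level.zero} {xs ys : List A} → All P xs → All P ys → All P (xs ʳ++ ys)
All-ʳ++ []         pys = pys
All-ʳ++ (px ∷ pxs) pys = All-ʳ++ pxs (px ∷ pys)

module _ {n : ℕ} where

  -- Letter counts and completed abelian squares

  infix 4 _≋_

  _≋_ : Word n → Word n → Set
  X ≋ Y = ∀ i → ν i X ≡ ν i Y

  ν-++ : ∀ i (X Y : Word n) → ν i (X ++ Y) ≡ ν i X + ν i Y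
  ν-++ i X Y = trans (cong length (filter-++ (i ≟_) X Y)) (length-++ (filter (i ≟_) X))

  ν-≡ : ∀ i (X : Word n) → ν i (i ∷ X) ≡ suc (ν i X)
  ν-≡ i X = cong length (filter-accept (i ≟_) refl)

  ν-≢ : ∀ {i x} (X : Word n) → i ≢ x → ν i (x ∷ X) ≡ ν i X
  ν-≢ {i} X i≢x = cong length (filter-reject (i ≟_) i≢x)

  ν-absent : ∀ {i} {X : Word n} → All (i ≢_) X → ν i X ≡ 0
  ν-absent {i} p = cong length (filter-none (i ≟_) p)

  ↭⇒≋ : {X Y : Word n} → X ↭ Y → X ≋ Y
  ↭⇒≋ p i = ↭-length (filter-↭ (i ≟_) p)

  content⇒≋ : (X Y : Word n) → content X ≡ content Y → X ≋ Y
  content⇒≋ X Y eq i = begin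
    ν i X                        ≡⟨ lookup∘tabulate (λ i → ν i X) i ⟨
    Vec.lookup (content X) i     ≡⟨ cong (λ v → Vec.lookup v i) eq ⟩
    Vec.lookup (content Y) i     ≡⟨ lookup∘tabulate (λ i → ν i Y) i ⟩
    ν i Y                        ∎
    where open ≡-Reasoning

  -- W a ends in the abelian square left (right a).
  record Completes (a : Fin n) (W : Word n) : Set where
    field
      before left right : Word n
      split   : W ≡ before ++ left ++ right
      balance : left ≋ a ∷ right

    square : Word n
    square = left ++ right

    ν-self : ν a square ≡ suc (2 * ν a right)
    ν-self = begin
      ν a (left ++ right)              ≡⟨ ν-++ a left right ⟩
      ν a left + ν a right             ≡⟨ cong (_+ ν a right) (trans (balance a) (ν-≡ a right)) ⟩
      suc (ν a right + ν a right)      ≡⟨ cong (λ k → suc (ν a right + k)) (+-identityʳ _) ⟨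
      suc (2 * ν a right)              ∎
      where open ≡-Reasoning

    ν-other : ∀ {i} → i ≢ a → ν i square ≡ 2 * ν i right
    ν-other {i} i≢a = begin
      ν i (left ++ right)              ≡⟨ ν-++ i left right ⟩
      ν i left + ν i right             ≡⟨ cong (_+ ν i right) (trans (balance i) (ν-≢ right i≢a)) ⟩
      ν i right + ν i right            ≡⟨ cong (ν i right +_) (+-identityʳ _) ⟨
      2 * ν i right                    ∎
      where open ≡-Reasoning

  open Completes

  Completes-∷ : ∀ {a W} b → Completes a W → Completes a (b ∷ W)
  Completes-∷ b c = record
    { before = b ∷ before c ; left = left c ; right = right c
    ; split = cong (b ∷_) (split c) ; balance = balance c }

  Completes⇒Contains : ∀ {a W} → Completes a W → Contains (AbelianSquare n) (W ∷ʳ a)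
  Completes⇒Contains {a} {W} c =
      left c ++ right c ∷ʳ a
    , subst (Infix _≡_ _) (sym eq) (Infix.fromView (MkView (before c) (≡⇒Pointwise-≡ refl) []))
    , left c , right c ∷ʳ a , left≢[] , right≢[]
    , Vec-tabulate-cong (λ i → trans (balance c i) (↭⇒≋ (++-comm [ a ] (right c)) i))
    , refl
    where
    left≢[] : left c ≢ []
    left≢[] l≡[] = 0≢1+n (trans (cong (ν a) (sym l≡[])) (trans (balance c a) (ν-≡ a (right c))))
    right≢[] : right c ∷ʳ a ≢ []
    right≢[] r≡[] = case ++-conicalʳ (right c) [ a ] r≡[] of λ ()
    eq : W ∷ʳ a ≡ before c ++ (left c ++ right c ∷ʳ a) ++ []
    eq = begin
      W ∷ʳ a                                        ≡⟨ cong (_∷ʳ a) (split c) ⟩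
      (before c ++ left c ++ right c) ∷ʳ a          ≡⟨ ++-assoc (before c) _ _ ⟩
      before c ++ (left c ++ right c) ∷ʳ a          ≡⟨ cong (before c ++_) (++-assoc (left c) _ _) ⟩
      before c ++ left c ++ right c ∷ʳ a            ≡⟨ cong (before c ++_) (++-identityʳ _) ⟨
      before c ++ (left c ++ right c ∷ʳ a) ++ []    ∎
      where open ≡-Reasoning

  -- Since `W` is free, the square must reach the appended letter; stripping that `a` from its right
  -- half leaves the required data.
  Contains⇒Completes : ∀ {a W} → FreeFrom (AbelianSquare n) W →
                       Contains (AbelianSquare n) (W ∷ʳ a) → Completes a W
  Contains⇒Completes {a} {W} free (S , inf , X , Y , X≢[] , Y≢[] , X~Y , refl) =
    go (Infix.toView inf) refl
    where
    -- The index `T` is general because the view cannot be matched directly against `W ∷ʳ a`.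
    go : ∀ {T} → Infix.View _≡_ (X ++ Y) T → T ≡ W ∷ʳ a → Completes a W
    go (MkView P pw Q) eq with Pointwise-≡⇒≡ pw | initLast Q
    ... | refl | Q′ ∷ʳ′ q = contradiction
          (X ++ Y , Infix.fromView (subst (Infix.View _≡_ (X ++ Y)) W≡ (MkView P pw Q′)) , X , Y , X≢[] , Y≢[] , X~Y , refl) free
      where
      W≡ : P ++ (X ++ Y) ++ Q′ ≡ W
      W≡ = ∷ʳ-injectiveˡ _ _ (trans (trans (++-assoc P _ _) (cong (P ++_) (++-assoc (X ++ Y) Q′ _))) eq)
    ... | refl | [] with initLast Y
    ... | [] = contradiction refl Y≢[]
    ... | Y′ ∷ʳ′ y with ∷ʳ-injective (P ++ X ++ Y′) W
                         (trans (trans (++-assoc P _ _) (cong (P ++_)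
                           (trans (++-assoc X Y′ _) (sym (++-identityʳ _))))) eq)
    ... | refl , refl = record
          { before = P ; left = X ; right = Y′ ; split = refl
          ; balance = λ i → trans (content⇒≋ X (Y′ ∷ʳ y) X~Y i) (↭⇒≋ (++-comm Y′ [ y ]) i) }

  -- Words without nonempty even factors

  record EvenWord (U : Word n) : Set where
    constructor evenWord
    field even : ∀ i → ∃ λ k → ν i U ≡ 2 * k

  odd⇒¬EvenWord : ∀ {U} i → (∃ λ k → ν i U ≡ suc (2 * k)) → ¬ EvenWord U
  odd⇒¬EvenWord i (k , odd) (evenWord even) with j , eq ← even i = even≢odd j k (trans (sym eq) odd)

  square⇒EvenWord : ∀ X Y → X ≋ Y → EvenWord (X ++ Y)
  square⇒EvenWord X Y X≋Y = evenWord λ i → ν i Y , (begin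
    ν i (X ++ Y)             ≡⟨ ν-++ i X Y ⟩
    ν i X + ν i Y            ≡⟨ cong₂ _+_ (X≋Y i) (sym (+-identityʳ _)) ⟩
    2 * ν i Y                ∎)
    where open ≡-Reasoning

  NoEvenPrefix : Pred (Word n) Level.zero
  NoEvenPrefix W = ∀ U {V} → U ++ V ≡ W → U ≢ [] → ¬ EvenWord U

  -- A factor is a prefix of a suffix, so one prefix condition is recorded for each nonempty suffix.
  data EvenFree : Pred (Word n) Level.zero where
    []  : EvenFree []
    _∷_ : ∀ {x W} → NoEvenPrefix (x ∷ W) → EvenFree W → EvenFree (x ∷ W)

  prefix⇒¬EvenWord : ∀ {U W} → NoEvenPrefix W → Prefix.PrefixView _≡_ U W → U ≢ [] → ¬ EvenWord U
  prefix⇒¬EvenWord nep (pw Prefix.++ _) with Pointwise-≡⇒≡ pw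
  ... | refl = nep _ refl

  infix⇒¬EvenWord : ∀ {U W} → EvenFree W → Infix _≡_ U W → U ≢ [] → ¬ EvenWord U
  infix⇒¬EvenWord []         (here Prefix.[]) U≢[] = contradiction refl U≢[]
  infix⇒¬EvenWord (nep ∷ _)  (here p)         = prefix⇒¬EvenWord nep (Prefix.toView p)
  infix⇒¬EvenWord (_ ∷ free) (there inf)      = infix⇒¬EvenWord free inf

  EvenFree⇒FreeFrom : ∀ {W} → EvenFree W → FreeFrom (AbelianSquare n) W
  EvenFree⇒FreeFrom free (U , inf , X , Y , X≢[] , _ , X~Y , refl) =
    infix⇒¬EvenWord free inf (X≢[] ∘ ++-conicalˡ X Y) (square⇒EvenWord X Y (content⇒≋ X Y X~Y))

  nep-[] : NoEvenPrefix []
  nep-[] U eq U≢[] = contradiction (++-conicalˡ U _ eq) U≢[]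

  -- A prefix either stays inside `A` or contains `x` exactly once.
  nep-separate : ∀ {x A B} → NoEvenPrefix A → All (x ≢_) A → All (x ≢_) B → NoEvenPrefix (A ++ x ∷ B)
  nep-separate {x} {A} {B} nep x∉A x∉B U eq U≢[] with ++-split U A eq
  ... | inj₁ (E , A≡ , _)           = nep U (sym A≡) U≢[]
  ... | inj₂ (_ , E , refl , refl) = odd⇒¬EvenWord x (0 , (begin
    ν x (A ++ x ∷ E)         ≡⟨ ν-++ x A (x ∷ E) ⟩
    ν x A + ν x (x ∷ E)      ≡⟨ cong₂ _+_ (ν-absent x∉A) (ν-≡ x E) ⟩
    suc (ν x E)              ≡⟨ cong suc (ν-absent (++⁻ˡ E x∉B)) ⟩
    1                        ∎))
    where open ≡-Reasoning

  nep-∷ʳ : ∀ {x A} → NoEvenPrefix A → ¬ EvenWord (A ∷ʳ x) → NoEvenPrefix (A ∷ʳ x)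
  nep-∷ʳ {x} {A} nep odd U eq U≢[] with ++-split U A eq
  ... | inj₁ (E , A≡ , _)            = nep U (sym A≡) U≢[]
  ... | inj₂ (_ , [] , refl , refl)  = odd

  -- Proper prefixes contain at most one `z` and fall under `nep-separate`; only the whole word
  -- needs its own witness of oddness.
  nep-bracket : ∀ {z A B} → NoEvenPrefix A → All (z ≢_) A → All (z ≢_) B →
                ¬ EvenWord (A ++ z ∷ (B ∷ʳ z)) → NoEvenPrefix (A ++ z ∷ (B ∷ʳ z))
  nep-bracket {z} {A} {B} nep z∉A z∉B odd rewrite sym (++-assoc A (z ∷ B) [ z ]) =
    nep-∷ʳ (nep-separate nep z∉A z∉B) odd

  EvenFree-separate : ∀ {x A B} → EvenFree A → EvenFree B → All (x ≢_) A → All (x ≢_) B →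
                      EvenFree (A ++ x ∷ B)
  EvenFree-separate []           free []           x∉B = nep-separate nep-[] [] x∉B ∷ free
  EvenFree-separate (nep ∷ freeA) free (x≢a ∷ x∉A) x∉B =
    nep-separate nep (x≢a ∷ x∉A) x∉B ∷ EvenFree-separate freeA free x∉A x∉B

  Unique⇒EvenFree : ∀ {W} → Unique W → EvenFree W
  Unique⇒EvenFree []            = []
  Unique⇒EvenFree (x∉W ∷ u) = nep-separate nep-[] [] x∉W ∷ Unique⇒EvenFree u

  -- The ladder words and the squares they complete

  rungs : Fin n → Word n → Word n
  rungs x []       = []
  rungs x (y ∷ ys) = y ∷ x ∷ rungs y ys

  -- What the mountain reads after the ascending `x`: `ys` up to the summit, then everything below
  -- the summit downwards. `R` lists the letters below `x`, highest first.
  descent : Word n → Fin n → Word n → Word n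
  descent R x []       = R
  descent R x (y ∷ ys) = y ∷ descent (x ∷ R) y ys

  -- Reading reverse R, x, ys upwards and then back down. Since it is also
  -- mountain (x ∷ R) y ys′ when ys = y ∷ ys′, climbing does not change it.
  mountain : Word n → Fin n → Word n → Word n
  mountain R x ys = (x ∷ R) ʳ++ descent R x ys

  -- The suffix of body [] x₁ … starting two letters later is again a body, with
  -- R grown by one letter; this drives all inductions on the ladder x₁, …, x_m.
  body : Fin n → Word n → Fin n → Word n → Word n
  body z R x ys = rungs x ys ++ z ∷ (mountain R x ys ∷ʳ z)

  rungs⁺ : ∀ {P : Pred (Fin n) Level.zero} {x} ys → All P (x ∷ ys) → All P (rungs x ys)
  rungs⁺ []       _                = []
  rungs⁺ (y ∷ ys) (px ∷ py ∷ pys) = py ∷ px ∷ rungs⁺ ys (py ∷ pys)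

  mountain⁺ : ∀ {P : Pred (Fin n) Level.zero} R x ys → All P (R ʳ++ x ∷ ys) → All P (mountain R x ys)
  -- Here `R ʳ++ [ x ]` is definitionally `reverse (x ∷ R)`.
  mountain⁺ R x []       p with All-resp-↭ (↭-reverse (x ∷ R)) p
  ... | px ∷ pR = All-ʳ++ (px ∷ pR) pR
  mountain⁺ R x (y ∷ ys) p = mountain⁺ (x ∷ R) y ys p

  body⁺ : ∀ {P : Pred (Fin n) Level.zero} {z} R x ys → P z → All P (x ∷ ys) → All P (R ʳ++ x ∷ ys) →
          All P (body z R x ys)
  body⁺ R x ys pz pys p =
    All-++⁺ (rungs⁺ ys pys) (pz ∷ All-++⁺ (mountain⁺ R x ys p) (pz ∷ []))

  -- Each rung `y x` pairs the ascending visit to `y` with the descending visit to `x`.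
  descent-↭ : ∀ R x ys → descent R x ys ↭ rungs x ys ++ R
  descent-↭ R x []       = ↭-refl
  descent-↭ R x (y ∷ ys) = prep y (↭-trans (descent-↭ (x ∷ R) y ys) (shift x (rungs y ys) R))

  mountain-split : ∀ z R x ys →
                   z ∷ (mountain R x ys ∷ʳ z) ≡ (z ∷ reverse (x ∷ R)) ++ descent R x ys ∷ʳ z
  mountain-split z R x ys = cong (z ∷_) (begin
    ((x ∷ R) ʳ++ descent R x ys) ∷ʳ z          ≡⟨ cong (_∷ʳ z) (ʳ++-defn (x ∷ R)) ⟩
    (reverse (x ∷ R) ++ descent R x ys) ∷ʳ z   ≡⟨ ++-assoc (reverse (x ∷ R)) _ _ ⟩
    reverse (x ∷ R) ++ descent R x ys ∷ʳ z     ∎)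
    where open ≡-Reasoning

  -- The cut falls just after the ascending `x`. Up to order the left half is `rungs x ys`, `z`, `x`
  -- and `R`; by `descent-↭` the right half is the same without `x`.
  completes-base : ∀ z R x ys → Completes x (body z R x ys)
  completes-base z R x ys = record
    { before = [] ; left = rungs x ys ++ z ∷ reverse (x ∷ R) ; right = descent R x ys ∷ʳ z
    ; split = trans (cong (rungs x ys ++_) (mountain-split z R x ys)) (sym (++-assoc (rungs x ys) _ _))
    ; balance = ↭⇒≋ (begin
        rungs x ys ++ z ∷ reverse (x ∷ R)   ↭⟨ ++⁺ˡ (rungs x ys) (prep z (↭-reverse (x ∷ R))) ⟩
        rungs x ys ++ z ∷ x ∷ R             ↭⟨ shift z (rungs x ys) (x ∷ R) ⟩
        z ∷ rungs x ys ++ x ∷ R             ↭⟨ prep z (shift x (rungs x ys) R) ⟩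
        z ∷ x ∷ rungs x ys ++ R             ↭⟨ prep z (prep x (descent-↭ R x ys)) ⟨
        z ∷ x ∷ descent R x ys              ↭⟨ ++-comm [ z ] (x ∷ descent R x ys) ⟩
        x ∷ descent R x ys ∷ʳ z             ∎) }
    where open PermutationReasoning

  -- Dropping the first rung leaves a body based at the next letter of the ladder.
  completes-ladder : ∀ {a} z R x ys → a ∈ x ∷ ys → Completes a (body z R x ys)
  completes-ladder z R x ys       (here refl) = completes-base z R x ys
  completes-ladder z R x (y ∷ ys) (there a∈)  =
    Completes-∷ y (Completes-∷ x (completes-ladder z (x ∷ R) y ys a∈))

  -- The square is `z z`, hence the empty right half.
  completes-last : ∀ W z → Completes z (W ∷ʳ z)
  completes-last W z = record { before = W ; left = [ z ] ; right = [] ; split = refl ; balance = λ _ → refl }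

  -- By completes-base the whole word is an abelian square short of one x.
  body-odd : ∀ z R x ys → ∃ λ k → ν x (body z R x ys) ≡ suc (2 * k)
  body-odd z R x ys = ν x (right c) , trans (cong (ν x) (split c)) (ν-self c)
    where c = completes-base z R x ys

  -- Crucial word of the optimal length

  -- Climbing to the summit leaves the word unchanged. The summit occurs once, and each slope has
  -- distinct letters.
  EvenFree-mountain : ∀ R x ys → Unique (R ʳ++ x ∷ ys) → EvenFree (mountain R x ys)
  EvenFree-mountain R x [] u with Unique-resp-↭ (↭-reverse (x ∷ R)) u
  ... | x∉R ∷ uR rewrite ʳ++-defn R {x ∷ R} =
    EvenFree-separate (Unique⇒EvenFree (Unique-resp-↭ (↭-sym (↭-reverse R)) uR)) (Unique⇒EvenFree uR)
                      (All-resp-↭ (↭-sym (↭-reverse R)) x∉R) x∉R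
  EvenFree-mountain R x (y ∷ ys) u = EvenFree-mountain (x ∷ R) y ys u

  -- From the start of a rung `y x`, a prefix ending before the first `z` is `y` alone or contains
  -- `x` once; one ending between the two `z` contains `z` once; the whole word is odd in `x`. Later
  -- starts follow by induction along the ladder.
  EvenFree-body : ∀ z R x ys → Unique (x ∷ ys) → All (z ≢_) (x ∷ ys) → All (z ≢_) (mountain R x ys) →
                  EvenFree (mountain R x ys) → EvenFree (body z R x ys)
  EvenFree-body z R x [] _ _ z∉M free =
      nep-bracket nep-[] [] z∉M (odd⇒¬EvenWord x (body-odd z R x []))
    ∷ EvenFree-separate free [] z∉M []
  EvenFree-body z R x (y ∷ ys) ((x≢y ∷ x∉ys) ∷ u) z∉@(z≢x ∷ z≢y ∷ z∉ys) z∉M free =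
      nep-bracket (nep-separate {A = [ y ]} (nep-separate nep-[] [] []) (x≢y ∷ []) x∉rungs)
                  (z≢y ∷ z≢x ∷ z∉rungs) z∉M (odd⇒¬EvenWord x odd)
    ∷ (nep-bracket (nep-separate nep-[] [] x∉rungs) (z≢x ∷ z∉rungs) z∉M
                   -- Removing the leading `y`, distinct from `x`, keeps the multiplicity of `x`
                   -- odd.
                   (odd⇒¬EvenWord x (proj₁ odd , trans (sym (ν-≢ _ x≢y)) (proj₂ odd)))
    ∷ EvenFree-body z (x ∷ R) y ys u (z≢y ∷ z∉ys) z∉M free)
    where
    odd = body-odd z R x (y ∷ ys)
    x∉rungs = rungs⁺ ys (x≢y ∷ x∉ys)
    z∉rungs = rungs⁺ ys (z≢y ∷ z∉ys)

  optimalWord : Fin n → Fin n → Fin n → Word n → Word n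
  optimalWord t z x ys = x ∷ t ∷ body z [] x ys

  -- The letter `t` occurs only once, so the two sides of it can be treated separately.
  optimalWord-free : ∀ {t z x ys} → Unique (t ∷ z ∷ x ∷ ys) → EvenFree (optimalWord t z x ys)
  optimalWord-free {t} {z} {x} {ys} ((t≢z ∷ t≢x ∷ t∉ys) ∷ z∉ ∷ u) =
    EvenFree-separate {A = [ x ]} (Unique⇒EvenFree ([] ∷ []))
      (EvenFree-body z [] x ys u z∉ (mountain⁺ [] x ys z∉) (EvenFree-mountain [] x ys u))
      (t≢x ∷ []) (body⁺ [] x ys t≢z (t≢x ∷ t∉ys) (t≢x ∷ t∉ys))

  optimalWord-completes : ∀ {a} t z x ys → a ∈ t ∷ z ∷ x ∷ ys → Completes a (optimalWord t z x ys)
  -- For `t` the square uses the whole word, cut after the first `z`. The initial `x` matches the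
  -- base of the mountain, and the rungs match `descent`.
  optimalWord-completes t z x ys (here refl) = record
    { before = [] ; left = x ∷ t ∷ rungs x ys ∷ʳ z ; right = mountain [] x ys ∷ʳ z
    ; split = cong (λ W → x ∷ t ∷ W) (sym (++-assoc (rungs x ys) _ _))
    ; balance = ↭⇒≋ (begin
        [ x ] ++ [ t ] ++ rungs x ys ∷ʳ z    ↭⟨ shift t [ x ] _ ⟩
        t ∷ x ∷ rungs x ys ∷ʳ z              ≡⟨ cong (λ W → t ∷ x ∷ W ∷ʳ z) (++-identityʳ _) ⟨
        t ∷ x ∷ (rungs x ys ++ []) ∷ʳ z      ↭⟨ ++⁺ʳ [ z ] (prep t (prep x (descent-↭ [] x ys))) ⟨
        t ∷ x ∷ descent [] x ys ∷ʳ z         ∎) }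
    where open PermutationReasoning
  optimalWord-completes t z x ys (there (here refl)) =
    subst (Completes z) (cong (λ W → x ∷ t ∷ W) (++-assoc (rungs x ys) _ _))
      (completes-last (x ∷ t ∷ rungs x ys ++ z ∷ mountain [] x ys) z)
  optimalWord-completes t z x ys (there (there a∈)) =
    Completes-∷ x (Completes-∷ t (completes-ladder z [] x ys a∈))

  length-rungs : ∀ x ys → length (rungs x ys) ≡ 2 * length ys
  length-rungs x []       = refl
  length-rungs x (y ∷ ys) = begin
    2 + length (rungs y ys)   ≡⟨ cong (2 +_) (length-rungs y ys) ⟩
    2 + 2 * length ys         ≡⟨ *-suc 2 (length ys) ⟨
    2 * suc (length ys)       ∎
    where open ≡-Reasoning

  length-mountain : ∀ x ys → length (mountain [] x ys) ≡ suc (2 * length ys)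
  length-mountain x ys = cong suc (begin
    length (descent [] x ys)    ≡⟨ ↭-length (descent-↭ [] x ys) ⟩
    length (rungs x ys ++ [])   ≡⟨ cong length (++-identityʳ (rungs x ys)) ⟩
    length (rungs x ys)         ≡⟨ length-rungs x ys ⟩
    2 * length ys               ∎)
    where open ≡-Reasoning

  length-optimalWord : ∀ t z x ys → length (optimalWord t z x ys) ≡ 4 * (3 + length ys) ∸ 7
  length-optimalWord t z x ys = begin
    2 + length (body z [] x ys)
      ≡⟨ cong (2 +_) (length-++ (rungs x ys)) ⟩
    2 + (length (rungs x ys) + suc (length (mountain [] x ys ∷ʳ z)))
      ≡⟨ cong₂ (λ k l → 2 + (k + suc l)) (length-rungs x ys)
               (trans (length-++ (mountain [] x ys)) (cong (_+ 1) (length-mountain x ys))) ⟩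
    2 + (2 * length ys + suc (suc (2 * length ys) + 1))
      -- Adding 7 first turns the truncated subtraction into a semiring identity.
      ≡⟨ m+n∸n≡m _ 7 ⟨
    2 + (2 * length ys + suc (suc (2 * length ys) + 1)) + 7 ∸ 7
      ≡⟨ cong (_∸ 7) (arith (length ys)) ⟩
    4 * (3 + length ys) ∸ 7 ∎
    where
    open ≡-Reasoning
    arith : ∀ k → 2 + (2 * k + suc (suc (2 * k) + 1)) + 7 ≡ 4 * (3 + k)
    arith = solve-∀

  -- Counting tools for the lower bound

  -- Suffixes of one word are nested, in the order of their lengths.
  suffix-ν : ∀ i P S P′ S′ → P ++ S ≡ P′ ++ S′ → length S ≤ length S′ → ν i S ≤ ν i S′
  suffix-ν i P S P′ S′ eq S≤S′ with ++-split P P′ eq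
  ... | inj₁ ([]    , _ , refl) = ≤-refl
  ... | inj₁ (e ∷ E , _ , refl) = contradiction
        (≤-trans (m≤n+m (length S′) (length E)) (≤-reflexive (sym (length-++ E)))) (<⇒≱ S≤S′)
  ... | inj₂ (e , E , _ , refl) =
        ≤-trans (m≤n+m (ν i S) (ν i (e ∷ E))) (≤-reflexive (sym (ν-++ i (e ∷ E) S)))

  others : Fin n → Word n → Word n
  others x = filter (¬? ∘ (x ≟_))

  length-others : ∀ x w → ν x w + length (others x w) ≡ length w
  length-others x []      = refl
  length-others x (y ∷ w) with x ≟ y
  ... | yes _ = cong suc (length-others x w)
  ... | no  _ = trans (+-suc (ν x w) _) (cong suc (length-others x w))

  ν-others : ∀ {i x} w → x ≢ i → ν i (others x w) ≡ ν i w
  ν-others         []      x≢i = refl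
  ν-others {i} {x} (y ∷ w) x≢i with x ≟ y
  ... | yes refl = trans (ν-others w x≢i) (sym (ν-≢ w (x≢i ∘ sym)))
  ... | no  _    with i ≟ y
  ...   | yes _ = cong suc (ν-others w x≢i)
  ...   | no  _ = ν-others w x≢i

  -- Deleting every `x` removes `ν x w` letters and preserves the counts of the remaining entries of
  -- `xs`.
  sum-ν≤length : ∀ {xs} w → Unique xs → sum (map (λ i → ν i w) xs) ≤ length w
  sum-ν≤length         w []         = z≤n
  sum-ν≤length {x ∷ xs} w (x∉xs ∷ u) = begin
    ν x w + sum (map (λ i → ν i w) xs)
      ≡⟨ cong (λ ks → ν x w + sum ks) (map-cong-local (All.map (ν-others w) x∉xs)) ⟨
    ν x w + sum (map (λ i → ν i (others x w)) xs)
      ≤⟨ +-monoʳ-≤ (ν x w) (sum-ν≤length (others x w) u) ⟩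
    ν x w + length (others x w)
      ≡⟨ length-others x w ⟩
    length w ∎
    where open ≤-Reasoning

-- A value below 2 equals 1, and its missing unit is supplied by the filtered list.
double-length≤ : ∀ {A : Set} (f : A → ℕ) → (∀ x → 1 ≤ f x) → ∀ xs →
                 2 * length xs ≤ sum (map f xs) + length (filter (λ x → f x <? 2) xs)
double-length≤ f 1≤f []       = z≤n
double-length≤ f 1≤f (x ∷ xs) = begin
  2 * suc (length xs)                                  ≡⟨ *-suc 2 (length xs) ⟩
  2 + 2 * length xs                                    ≤⟨ step (light? x) ⟩
  f x + total + length (filter light? (x ∷ xs))        ∎
  where
  open ≤-Reasoning
  light? : Decidable (λ x → f x < 2)
  light? x = f x <? 2
  total lights : ℕ
  total  = sum (map f xs)
  lights = length (filter light? xs)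
  arith : ∀ a b c → suc a + (b + c) ≡ a + b + suc c
  arith = solve-∀
  step : Dec (f x < 2) → 2 + 2 * length xs ≤ f x + total + length (filter light? (x ∷ xs))
  step (yes fx<2) = begin
    2 + 2 * length xs                                  ≤⟨ +-mono-≤ (s≤s (1≤f x)) (double-length≤ f 1≤f xs) ⟩
    suc (f x) + (total + lights)                       ≡⟨ arith (f x) total lights ⟩
    f x + total + suc lights                           ≡⟨ cong (λ L → f x + total + length L) (filter-accept light? fx<2) ⟨
    f x + total + length (filter light? (x ∷ xs))      ∎
  step (no fx≮2) = begin
    2 + 2 * length xs                                  ≤⟨ +-mono-≤ (≮⇒≥ fx≮2) (double-length≤ f 1≤f xs) ⟩
    f x + (total + lights)                             ≡⟨ +-assoc (f x) total lights ⟨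
    f x + total + lights                               ≡⟨ cong (λ L → f x + total + length L) (filter-reject light? fx≮2) ⟨
    f x + total + length (filter light? (x ∷ xs))      ∎

AllPairs-lookup : ∀ {A : Set} {R : A → A → Set} {xs} → AllPairs R xs →
                  ∀ {i j} → i Fin.< j → R (lookup xs i) (lookup xs j)
AllPairs-lookup (rx ∷ _)  {zero}  {suc j} _         = All.lookup rx (∈-lookup j)
AllPairs-lookup (_ ∷ rxs) {suc i} {suc j} (s≤s i<j) = AllPairs-lookup rxs i<j

-- By the pigeonhole principle, a longer list would repeat an element.
Unique⇒length≤ : ∀ {A : Set} {xs : List A} {m} (f : A → Fin m) → Unique xs →
                 (∀ {x y} → x ∈ xs → y ∈ xs → f x ≡ f y → x ≡ y) → length xs ≤ m
Unique⇒length≤ {xs = xs} f u inj = ≮⇒≥ λ m<l →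
  let i , j , i<j , fi≡fj = pigeonhole m<l (f ∘ lookup xs)
  in AllPairs-lookup u i<j (inj (∈-lookup i) (∈-lookup j) fi≡fj)

positive-double : ∀ k → 1 ≤ 2 * k → 1 ≤ k
positive-double (suc k) _ = s≤s z≤n

double≥2 : ∀ k → 1 ≤ 2 * k → 2 ≤ 2 * k
double≥2 k 1≤2k = *-monoʳ-≤ 2 (positive-double k 1≤2k)

-- Light letters and the lower bound

module LowerBound
  {n : ℕ} {W : Word n} (completes : ∀ a → Completes a W) (c : Fin n)
  (maximal : ∀ a → length (Completes.square (completes a)) ≤ length (Completes.square (completes c)))
  where

  open Completes

  Ω : Fin n → Word n
  Ω a = square (completes a)

  Y : Word n
  Y = right (completes c)

  Ω-mono : ∀ {a b} i → length (Ω a) ≤ length (Ω b) → ν i (Ω a) ≤ ν i (Ω b)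
  Ω-mono {a} {b} i = suffix-ν i (before (completes a)) (Ω a) (before (completes b)) (Ω b)
    (trans (sym (split (completes a))) (split (completes b)))

  Y-suffix : ∃ λ P → W ≡ P ++ Y
  Y-suffix = before (completes c) ++ left (completes c)
         , trans (split (completes c)) (sym (++-assoc (before (completes c)) _ _))

  Ω≤Y : ∀ {a} i → length (Ω a) ≤ length Y → ν i (Ω a) ≤ ν i Y
  Ω≤Y {a} i = suffix-ν i (before (completes a)) (Ω a) _ Y
    (trans (sym (split (completes a))) (proj₂ Y-suffix))

  Y≤Ω : ∀ {a} i → length Y ≤ length (Ω a) → ν i Y ≤ ν i (Ω a)
  Y≤Ω {a} i = suffix-ν i _ Y (before (completes a)) (Ω a)
    (trans (sym (proj₂ Y-suffix)) (split (completes a)))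

  ν-Ω≥1 : ∀ {a b} → length (Ω a) ≤ length (Ω b) → 1 ≤ ν a (Ω b)
  ν-Ω≥1 {a} Ωa≤Ωb = ≤-trans (≤-trans (s≤s z≤n) (≤-reflexive (sym (ν-self (completes a))))) (Ω-mono a Ωa≤Ωb)

  ν-Y≥1 : ∀ {i} → i ≢ c → 1 ≤ ν i Y
  ν-Y≥1 {i} i≢c = positive-double _
    (≤-trans (ν-Ω≥1 (maximal i)) (≤-reflexive (ν-other (completes c) i≢c)))

  ν≥1 : ∀ i → 1 ≤ ν i (c ∷ Y)
  ν≥1 i with i ≟ c
  ... | yes refl = s≤s z≤n
  ... | no  i≢c  = ν-Y≥1 i≢c

  -- The multiplicity is even, so one occurrence forces a second.
  ν-Ω≥2 : ∀ {a i} → i ≢ a → 1 ≤ ν i (Ω a) → 2 ≤ ν i (Ω a)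
  ν-Ω≥2 {a} {i} i≢a rewrite ν-other (completes a) i≢a = double≥2 (ν i (right (completes a)))

  -- The multiplicity is odd, so two occurrences force a third.
  ν-Ω-self≥3 : ∀ {a} → 2 ≤ ν a (Ω a) → 3 ≤ ν a (Ω a)
  ν-Ω-self≥3 {a} rewrite ν-self (completes a) = λ { (s≤s 1≤2k) → s≤s (double≥2 (ν a (right (completes a))) 1≤2k) }

  -- Equivalently, i occurs only once in the left half of Ω c.
  Light : Fin n → Set
  Light i = ν i (c ∷ Y) < 2

  light-Y : ∀ {i} → i ≢ c → Light i → ν i Y < 2
  light-Y i≢c = subst (_< 2) (ν-≢ Y i≢c)

  -- Otherwise the two or more copies of `i` in `Ω j` would lie in `Y`, which has at most one.
  longer : ∀ {i j} → i ≢ c → i ≢ j → Light i → length (Ω i) ≤ length (Ω j) → length Y ≤ length (Ω j)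
  longer {i} {j} i≢c i≢j light Ωi≤Ωj = ≮⇒≥ λ Ωj<Y →
    <⇒≱ (light-Y i≢c light) (≤-trans (ν-Ω≥2 i≢j (ν-Ω≥1 Ωi≤Ωj)) (Ω≤Y i (<⇒≤ Ωj<Y)))

  -- Otherwise `Ω i` contains `Y` and hence `j`, so at least twice by parity; then `Ω j` contains
  -- `j` three times, but `Ω c` at most twice.
  shorter : ∀ {i j} → j ≢ c → j ≢ i → Light j → length (Ω i) ≤ length (Ω j) → length (Ω i) < length Y
  shorter {i} {j} j≢c j≢i light Ωi≤Ωj = ≰⇒> λ Y≤Ωi →
    <⇒≱ (begin-strict
      ν j (Ω j)        ≤⟨ Ω-mono j (maximal j) ⟩
      ν j (Ω c)        ≡⟨ ν-other (completes c) j≢c ⟩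
      2 * ν j Y        ≤⟨ *-monoʳ-≤ 2 (≤-pred (light-Y j≢c light)) ⟩
      2                <⟨ ≤-refl ⟩
      3                ∎)
    (ν-Ω-self≥3 (≤-trans (ν-Ω≥2 j≢i (≤-trans (ν-Y≥1 j≢c) (Y≤Ω j Y≤Ωi))) (Ω-mono j Ωi≤Ωj)))
    where open ≤-Reasoning

  classOf : ∀ {P Q : Set} → Dec P → Dec Q → Fin 3
  classOf (yes _) _       = zero
  classOf (no  _) (yes _) = suc zero
  classOf (no  _) (no  _) = suc (suc zero)

  class : Fin n → Fin 3
  class i = classOf (i ≟ c) (length (Ω i) <? length Y)

  -- For distinct light letters other than `c`, `longer` makes the longer suffix at least as long as
  -- `Y`, and `shorter` makes the other one shorter than `Y`; so their classes differ.
  class-injective : ∀ {i j} → Light i → Light j → class i ≡ class j → i ≡ j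
  class-injective {i} {j} light-i light-j =
    go (i ≟ c) (j ≟ c) (length (Ω i) <? length Y) (length (Ω j) <? length Y) (i ≟ j)
       (≤-total (length (Ω i)) (length (Ω j)))
    where
    go : (p : Dec (i ≡ c)) (q : Dec (j ≡ c))
         (r : Dec (length (Ω i) < length Y)) (s : Dec (length (Ω j) < length Y)) →
         Dec (i ≡ j) → length (Ω i) ≤ length (Ω j) ⊎ length (Ω j) ≤ length (Ω i) →
         classOf p r ≡ classOf q s → i ≡ j
    go (yes i≡c) (yes j≡c) _          _          _         _          _ = trans i≡c (sym j≡c)
    go (yes _)   (no _)    _          (yes _)    _         _          ()
    go (yes _)   (no _)    _          (no _)     _         _          ()
    go (no _)    (yes _)   (yes _)    _          _         _          ()
    go (no _)    (yes _)   (no _)     _          _         _          ()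
    go (no _)    (no _)    (yes _)    (no _)     _         _          ()
    go (no _)    (no _)    (no _)     (yes _)    _         _          ()
    go (no _)    (no _)    (yes _)    (yes _)    (yes i≡j) _          _ = i≡j
    go (no _)    (no _)    (no _)     (no _)     (yes i≡j) _          _ = i≡j
    go (no i≢c)  (no _)    (yes _)    (yes Ωj<Y) (no i≢j)  (inj₁ i≤j) _ =
      contradiction (longer i≢c i≢j light-i i≤j) (<⇒≱ Ωj<Y)
    go (no _)    (no j≢c)  (yes Ωi<Y) (yes _)    (no i≢j)  (inj₂ j≤i) _ =
      contradiction (longer j≢c (i≢j ∘ sym) light-j j≤i) (<⇒≱ Ωi<Y)
    go (no _)    (no j≢c)  (no Ωi≮Y)  (no _)     (no i≢j)  (inj₁ i≤j) _ =
      contradiction (shorter j≢c (i≢j ∘ sym) light-j i≤j) Ωi≮Y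
    go (no i≢c)  (no _)    (no _)     (no Ωj≮Y)  (no i≢j)  (inj₂ j≤i) _ =
      contradiction (shorter i≢c i≢j light-i j≤i) Ωj≮Y

  -- Stated up to rearrangement so that it serves both halves of the square completed by `c`. The 3
  -- is the number of classes of light letters.
  half-bound : ∀ w → w ≋ c ∷ Y → 2 * n ≤ length w + 3
  half-bound w w≋ = begin
    2 * n                                                     ≡⟨ cong (2 *_) (length-tabulate {n = n} _) ⟨
    2 * length (allFin n)                                     ≤⟨ double-length≤ (λ i → ν i w) w≥1 (allFin n) ⟩
    sum (map (λ i → ν i w) (allFin n)) + length lights
      ≤⟨ +-mono-≤ (sum-ν≤length w (Unique.allFin⁺ n))
                  (Unique⇒length≤ class (Unique.filter⁺ light? (Unique.allFin⁺ n))
                    λ x∈ y∈ → class-injective (light x∈) (light y∈)) ⟩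
    length w + 3                                              ∎
    where
    open ≤-Reasoning
    w≥1 : ∀ i → 1 ≤ ν i w
    w≥1 i = subst (1 ≤_) (sym (w≋ i)) (ν≥1 i)
    light? : Decidable (λ i → ν i w < 2)
    light? i = ν i w <? 2
    lights : List (Fin n)
    lights = filter light? (allFin n)
    light : ∀ {i} → i ∈ lights → Light i
    light {i} i∈ = subst (_< 2) (w≋ i) (proj₂ (∈-filter⁻ light? {xs = allFin n} i∈))

  bound : 4 * n ∸ 7 ≤ length W
  bound = m≤n+o⇒m∸n≤o (4 * n) 7 (begin
    4 * n                                    ≡⟨ *-assoc 2 2 n ⟩
    2 * (2 * n)                              ≡⟨ cong (2 * n +_) (+-identityʳ (2 * n)) ⟩
    -- The right half is counted with the appended `c`, which is not part of `W`: this adds 1 to the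
    -- deficit 3 + 3.
    2 * n + 2 * n                            ≤⟨ +-mono-≤ (half-bound X (balance (completes c))) (half-bound (c ∷ Y) λ _ → refl) ⟩
    length X + 3 + (suc (length Y) + 3)      ≡⟨ arith (length X) (length Y) ⟩
    7 + (length X + length Y)                ≡⟨ cong (7 +_) (length-++ X) ⟨
    7 + length (Ω c)                         ≤⟨ +-monoʳ-≤ 7 (m≤n+m _ (length (before (completes c)))) ⟩
    7 + (length (before (completes c)) + length (Ω c))
      ≡⟨ cong (7 +_) (trans (cong length (split (completes c))) (length-++ (before (completes c)))) ⟨
    7 + length W                             ∎)
    where
    open ≤-Reasoning
    X = left (completes c)
    arith : ∀ a b → a + 3 + (suc b + 3) ≡ 7 + (a + b)
    arith = solve-∀

-- Both bounds combined

crucial⇒length≥ : ∀ {n} W → Crucial (AbelianSquare (suc n)) W → 4 * suc n ∸ 7 ≤ length W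
-- The nonempty alphabet provides the default `zero` for `argmax`.
crucial⇒length≥ {n} W (free , contains) = LowerBound.bound completes longest
  λ a → All.lookup (f[xs]≤f[argmax] {f = size} zero (allFin (suc n))) (∈-allFin a)
  where
  completes : ∀ a → Completes a W
  completes a = Contains⇒Completes free (contains a)
  size : Fin (suc n) → ℕ
  size a = length (Completes.square (completes a))
  longest : Fin (suc n)
  longest = argmax size zero (allFin (suc n))

optimalWord-crucial : ∀ {n t z x ys} → allFin n ≡ t ∷ z ∷ x ∷ ys → Crucial (AbelianSquare n) (optimalWord t z x ys)
optimalWord-crucial {n} {t} {z} {x} {ys} eq =
    EvenFree⇒FreeFrom (optimalWord-free (subst Unique eq (Unique.allFin⁺ n)))
  , λ a → Completes⇒Contains (optimalWord-completes t z x ys (subst (a ∈_) eq (∈-allFin a)))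

theorem2 : (n : ℕ) → n > 2 → IsLmin (AbelianSquare n) (4 * n ∸ 7)
theorem2 (suc (suc (suc m))) (s≤s (s≤s (s≤s z≤n))) =
    ( optimalWord t z x ys
    -- `allFin (3 + m)` unfolds definitionally to `t ∷ z ∷ x ∷ ys`.
    , optimalWord-crucial refl
    , trans (length-optimalWord t z x ys) (cong (λ k → 4 * (3 + k) ∸ 7) (length-tabulate {n = m} _)) )
  , crucial⇒length≥
  where
  t z x : Fin (3 + m)
  t = zero
  z = suc zero
  x = suc (suc zero)
  ys : Word (3 + m)
  ys = tabulate λ i → suc (suc (suc i))
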